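{- Let $n\geq 3$ and let $q$ be a prime power. Suppose that $\mathcal{L}$ is a Cameron-Liebler line class in $\mathrm{AG}(n,q)$ with parameter $x$. Then $$x(x-1)\frac{q^{n-2}-1}{q-1}\equiv 0 \pmod{2(q+1)}.$$
   Context: A line spread of the affine space $\mathrm{AG}(n,q)$ is a set of lines of $\mathrm{AG}(n,q)$ partitioning its point set. A Cameron-Liebler line class with parameter $x$ in $\mathrm{AG}(n,q)$ is a set $\mathcal{L}$ of lines of $\mathrm{AG}(n,q)$ such that $|\mathcal{L}\cap\mathcal{S}|=x$ for every line spread $\mathcal{S}$ of $\mathrm{AG}(n,q)$. -}

module Defs where

open import Data.Nat using (ℕ; _^_)
open import Data.Bool using (Bool; true)
open import Data.Fin using (Fin)
open import Data.List using (List; length; filterᵇ; map; upTo; lookup)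
open import Data.Nat.ListAction using (sum)
open import Data.Vec using (Vec; zipWith; replicate) renaming (map to vmap)
open import Data.Product using (Σ; ∃; ∃-syntax; _×_)
open import Relation.Nullary using (¬_)
open import Relation.Binary.PropositionalEquality using (_≡_)
open import Algebra.Structures using (IsCommutativeRing)
open import Function.Bundles using (_↔_)

record FiniteField (q : ℕ) : Set₁ where
  field
    Carrier : Set
    _+_ _*_ : Carrier → Carrier → Carrier
    -_ : Carrier → Carrier
    0# 1# : Carrier
    isCommutativeRing : IsCommutativeRing _≡_ _+_ _*_ -_ 0# 1#
    0≢1 : ¬ (0# ≡ 1#)
    inverse : ∀ a → ¬ (a ≡ 0#) → ∃[ b ] (a * b ≡ 1#)
    enumeration : Fin q ↔ Carrier

module AffineSpace {q : ℕ} (F : FiniteField q) (n : ℕ) where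
  open FiniteField F

  Point : Set
  Point = Vec Carrier n

  _⊕_ : Point → Point → Point
  _⊕_ = zipWith _+_

  _·_ : Carrier → Point → Point
  t · v = vmap (t *_) v

  zeroVec : Point
  zeroVec = replicate n 0#

  record Line : Set where
    field
      pts : Point → Bool
      base dir : Point
      dir≢0 : ¬ (dir ≡ zeroVec)
      isLine : ∀ y → (pts y ≡ true → ∃[ t ] (y ≡ base ⊕ (t · dir)))
                   × (∃[ t ] (y ≡ base ⊕ (t · dir)) → pts y ≡ true)

  open Line public

  _∈ᴸ_ : Point → Line → Set
  y ∈ᴸ ℓ = pts ℓ y ≡ true

  IsLineSpread : List Line → Set
  IsLineSpread S = ∀ y → (∃[ i ] (y ∈ᴸ lookup S i))
                        × (∀ i j → y ∈ᴸ lookup S i → y ∈ᴸ lookup S j → i ≡ j)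

  LineSet : Set
  LineSet = Line → Bool

  -- |𝓛 ∩ 𝒮| for a set of lines 𝓛 and a spread 𝒮 (whose lines are distinct)
  ∣_∩_∣ : LineSet → List Line → ℕ
  ∣ 𝓛 ∩ S ∣ = length (filterᵇ 𝓛 S)

  IsCameronLieblerLineClass : LineSet → ℕ → Set
  IsCameronLieblerLineClass 𝓛 x = ∀ S → IsLineSpread S → ∣ 𝓛 ∩ S ∣ ≡ x

-- (q^k - 1)/(q - 1) = 1 + q + ... + q^(k-1)
gaussNum : ℕ → ℕ → ℕ
gaussNum q k = sum (map (q ^_) (upTo k))

-- Write χ(p, d) for the indicator that the line p + ⟨d⟩ belongs to 𝓛, and [m] for
-- (q^m - 1) / (q - 1). In a spread of parallel lines one may turn all the lines inside one
-- plane into another direction of that plane, so within a plane every parallel class contains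
-- the same number of lines of 𝓛. This alone makes χ come from a weight on points: if k(p) is
-- the number of lines of 𝓛 through p in a plane minus the number of lines of 𝓛 in a parallel
-- class of that plane, then p lies on k(p) [n-1] + x lines of 𝓛, and k sums to q χ(ℓ) over
-- every line ℓ. Hence k sums to q x, and counting Σ k(p) over the incident pairs (p, ℓ) with
-- ℓ in 𝓛 in two ways gives [n-1] Σ k² + q x² = q x [n]. Because Σ k² and Σ k = q x have the
-- same parity, 2 [n-1] divides q x (x - 1), and q + 1 divides [n-1] [n-2].

module Submission where

open import Defs
open import Data.Nat as ℕ using (ℕ; zero; suc)
import Data.Nat.Properties as ℕₚ
open import Data.Nat.Divisibility using (_∣_; _∣0; ∣m+n∣m⇒∣n; ∣m∣n⇒∣m+n; ∣m⇒∣m*n; ∣n⇒∣m*n; m∣m*n; *-monoʳ-∣; *-monoˡ-∣)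
open import Data.Bool using (Bool; true; false)
open import Data.Fin using (Fin; zero; suc; punchIn)
open import Data.Fin.Properties using (any?; nonZeroIndex; punchInᵢ≢i; *↔×)
open import Data.List as List using (List; []; _∷_; lookup; deduplicate)
open import Data.List.Properties using (map-applyUpTo; map-upTo)
open import Data.List.Membership.Propositional.Properties using (∈-lookup)
open import Data.List.Relation.Unary.All as All using (All)
open import Data.List.Relation.Unary.AllPairs as AllPairs using (AllPairs; _∷_)
open import Data.List.Relation.Unary.Any as Any using (Any; there)
import Data.List.Relation.Unary.All.Properties as Allₚ
import Data.List.Relation.Unary.AllPairs.Properties as AllPairsₚ
import Data.List.Relation.Unary.Any.Properties as Anyₚ
open import Data.List.Relation.Unary.Unique.DecSetoid.Properties using (deduplicate-!)
open import Data.Vec as Vec using (Vec; []; _∷_; map; zipWith; replicate)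
open import Data.Vec.Functional using (removeAt)
open import Data.Vec.Properties using (zipWith-assoc; zipWith-comm; zipWith-identityˡ; zipWith-identityʳ; map-cong; map-∘; map-id; map-const; map-replicate; ∷-injectiveˡ; ∷-injectiveʳ)
open import Data.Product using (∃; ∃-syntax; _×_; _,_; uncurry; proj₁; proj₂)
open import Data.Product.Function.NonDependent.Propositional using (_×-↔_)
open import Function.Base using (_∘_)
open import Function.Bundles using (_↔_; Inverse; mk↔ₛ′)
open import Function.Construct.Composition using (_↔-∘_)
open import Function.Construct.Identity using (↔-id)
open import Function.Construct.Symmetry using (↔-sym)
open import Function.Properties.Inverse using (↔⇒↣)
open import Relation.Nullary using (¬_; Dec; yes; no; contradiction; does; ¬?)
open import Relation.Nullary.Decidable using (map′; via-injection; dec-true; dec-false)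
open import Relation.Binary.Bundles using (DecSetoid)
open import Relation.Binary.Definitions using (DecidableEquality)
open import Relation.Binary.PropositionalEquality
open import Algebra.Bundles using (AbelianGroup; CommutativeRing)
open import Algebra.Structures using (IsCommutativeRing)
import Algebra.Properties.Group as GroupProperties
open import Level using (0ℓ)
open Inverse using (to; from; strictlyInverseˡ; strictlyInverseʳ)

private variable
  N M : ℕ
  X Y : Set

-- Types with a finite enumeration.

module _ (E : Fin N ↔ X) where

  -- `FiniteField` postulates no decidable equality on its carrier; the enumeration supplies it, for
  -- scalars and for points alike.
  ≟-finite : DecidableEquality X
  ≟-finite = via-injection (↔⇒↣ (↔-sym E)) Data.Fin.Properties._≟_

  any-finite? : {P : X → Set} → (∀ x → Dec (P x)) → Dec (∃ P)
  any-finite? {P} P? = map′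
    (λ (i , p) → to E i , p)
    (λ (x , p) → from E x , subst P (sym (strictlyInverseˡ E x)) p)
    (any? (P? ∘ to E))

vec-enum : Fin N ↔ X → ∀ n → Fin (N ℕ.^ n) ↔ Vec X n
vec-enum E zero    = mk↔ₛ′ (λ _ → []) (λ _ → zero) (λ { [] → refl }) (λ { zero → refl })
vec-enum E (suc n) =
  mk↔ₛ′ (uncurry Vec._∷_) (λ { (x ∷ v) → x , v }) (λ { (x ∷ v) → refl }) (λ _ → refl)
  ↔-∘ ((E ×-↔ vec-enum E n) ↔-∘ *↔×)

-- Gaussian numbers.

module GaussNumbers where
  open import Data.Nat using (_+_; _*_; _^_)
  open import Data.Nat.ListAction using (sum)
  open import Data.Nat.Properties using (*-zeroʳ; *-distribˡ-+)
  open import Data.Nat.Tactic.RingSolver using (solve-∀)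

  sum-map-* : ∀ c ms → sum (List.map (c *_) ms) ≡ c * sum ms
  sum-map-* c []       = sym (*-zeroʳ c)
  sum-map-* c (m ∷ ms) = trans (cong (c * m +_) (sum-map-* c ms)) (sym (*-distribˡ-+ c m (sum ms)))

  gaussNum-suc : ∀ q k → gaussNum q (suc k) ≡ 1 + q * gaussNum q k
  gaussNum-suc q k = cong suc (begin
    sum (List.map (q ^_) (List.applyUpTo suc k))       ≡⟨ cong sum (map-applyUpTo suc (q ^_) k) ⟩
    sum (List.applyUpTo (λ i → q * q ^ i) k)         ≡⟨ cong sum (map-applyUpTo (q ^_) (q *_) k) ⟨
    sum (List.map (q *_) (List.applyUpTo (q ^_) k))    ≡⟨ sum-map-* q (List.applyUpTo (q ^_) k) ⟩
    q * sum (List.applyUpTo (q ^_) k)                  ≡⟨ cong (λ ms → q * sum ms) (map-upTo (q ^_) k) ⟨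
    q * gaussNum q k                                   ∎)
    where open ≡-Reasoning

  -- One of two consecutive indices is even, and q + 1 divides the Gaussian number at an even index.
  -- The induction avoids that case distinction through [k+2] = 1 + q + q² [k].
  q+1∣gaussNum*gaussNum : ∀ q k → (q + 1) ∣ gaussNum q (suc k) * gaussNum q k
  q+1∣gaussNum*gaussNum q zero    = subst ((q + 1) ∣_) (sym (*-zeroʳ (gaussNum q 1))) ((q + 1) ∣0)
  q+1∣gaussNum*gaussNum q (suc k) = subst ((q + 1) ∣_) (sym (begin
    gaussNum q (suc (suc k)) * b
      ≡⟨ cong (_* b) (trans (gaussNum-suc q (suc k)) (cong (λ c → 1 + q * c) (gaussNum-suc q k))) ⟩
    (1 + q * (1 + q * a)) * b
      ≡⟨ expand q a b ⟩
    (q + 1) * b + q * q * (b * a) ∎))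
    (∣m∣n⇒∣m+n (m∣m*n b) (∣n⇒∣m*n (q * q) (q+1∣gaussNum*gaussNum q k)))
    where
    open ≡-Reasoning
    a = gaussNum q k
    b = gaussNum q (suc k)
    expand : ∀ q a b → (1 + q * (1 + q * a)) * b ≡ (q + 1) * b + q * q * (b * a)
    expand = solve-∀

open GaussNumbers

field-size : ∀ {q} → FiniteField q → 2 ℕ.≤ q
field-size {zero}        F with () ← from (FiniteField.enumeration F) (FiniteField.0# F)
field-size {suc zero}    F = contradiction
  (trans (sym (strictlyInverseˡ enumeration 0#))
    (trans (cong (to enumeration) (Fin1-unique (from enumeration 0#) (from enumeration 1#))) (strictlyInverseˡ enumeration 1#)))
  0≢1
  where
  open FiniteField F
  Fin1-unique : (i j : Fin 1) → i ≡ j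
  Fin1-unique zero zero = refl
field-size {suc (suc q)} F = ℕ.s≤s (ℕ.s≤s ℕ.z≤n)

-- Integer sums over enumerated types.

module IntegerSums where
  open import Data.Integer using (ℤ; +_; -[1+_]; 0ℤ; 1ℤ; _+_; _*_; _-_; -_; ∣_∣; NonZero) public
  open import Data.Integer.Properties public
  open import Data.Integer.Tactic.RingSolver using (solve-∀) public
  open import Algebra.Properties.Semiring.Sum +-*-semiring as Sum using (sum; sum-remove)
  open GroupProperties (AbelianGroup.group +-0-abelianGroup) using () renaming (∙-cancelʳ to +-cancelʳ; ∙-cancelˡ to +-cancelˡ) public

  opaque
    ∑ : Fin N ↔ X → (X → ℤ) → ℤ
    ∑ E f = sum (f ∘ to E)

  module _ (E : Fin N ↔ X) where

    opaque
      unfolding ∑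

      ∑-cong : ∀ {f g : X → ℤ} → (∀ x → f x ≡ g x) → ∑ E f ≡ ∑ E g
      ∑-cong f≗g = Sum.sum-cong-≗ (f≗g ∘ to E)

      ∑-+ : ∀ f g → ∑ E (λ x → f x + g x) ≡ ∑ E f + ∑ E g
      ∑-+ f g = Sum.∑-distrib-+ (f ∘ to E) (g ∘ to E)

      ∑-*ˡ : ∀ c f → ∑ E (λ x → c * f x) ≡ c * ∑ E f
      ∑-*ˡ c f = sym (Sum.*-distribˡ-sum c (f ∘ to E))

      ∑-*ʳ : ∀ c f → ∑ E (λ x → f x * c) ≡ ∑ E f * c
      ∑-*ʳ c f = sym (Sum.*-distribʳ-sum c (f ∘ to E))

      ∑-swap : (H : Fin M ↔ Y) (f : X → Y → ℤ) →
               ∑ E (λ x → ∑ H (f x)) ≡ ∑ H (λ y → ∑ E (λ x → f x y))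
      ∑-swap H f = Sum.∑-comm (λ i j → f (to E i) (to H j))

      ∑-reindex : (φ : X ↔ X) (f : X → ℤ) → ∑ E (f ∘ to φ) ≡ ∑ E f
      ∑-reindex φ f = begin
        sum (f ∘ to φ ∘ to E)          ≡⟨ Sum.sum-cong-≗ {N} (λ i → cong f (sym (strictlyInverseˡ E (to φ (to E i))))) ⟩
        sum (f ∘ to E ∘ to π)          ≡⟨ Sum.sum-permute (f ∘ to E) π ⟨
        sum (f ∘ to E)                 ∎
        where
        open ≡-Reasoning
        π : Fin N ↔ Fin N
        π = ↔-sym E ↔-∘ (φ ↔-∘ E)

  opaque
    unfolding ∑

    ∑-const : (E : Fin N ↔ X) (c : ℤ) → ∑ E (λ _ → c) ≡ + N * c
    ∑-const {N} _ c = go N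
      where
      go : ∀ m → sum {m} (λ _ → c) ≡ + m * c
      go zero    = refl
      go (suc m) = trans (cong (λ s → c + s) (go m)) (sym (suc-* (+ m) c))

    ∑-except : (E : Fin N ↔ X) (z : X) {f g : X → ℤ} → (∀ x → x ≢ z → f x ≡ g x) →
               ∑ E f + g z ≡ ∑ E g + f z
    ∑-except {zero}  E z _ with () ← from E z
    ∑-except {suc N} {A} E z {f} {g} f≗g = begin
      ∑ E f + g z         ≡⟨ cong (_+ g z) (split f) ⟩
      f z + rest f + g z  ≡⟨ cong (λ r → f z + r + g z) (Sum.sum-cong-≗ (λ j → f≗g _ (z∉ j))) ⟩
      f z + rest g + g z  ≡⟨ swap (f z) (rest g) (g z) ⟩
      g z + rest g + f z  ≡⟨ cong (_+ f z) (split g) ⟨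
      ∑ E g + f z         ∎
      where
      open ≡-Reasoning
      i : Fin (suc N)
      i = from E z
      rest : (A → ℤ) → ℤ
      rest h = sum (removeAt (h ∘ to E) i)
      split : ∀ h → ∑ E h ≡ h z + rest h
      split h = trans (sum-remove {i = i} (h ∘ to E)) (cong (λ y → h y + rest h) (strictlyInverseˡ E z))
      z∉ : ∀ j → to E (punchIn i j) ≢ z
      z∉ j eq = punchInᵢ≢i i j (trans (sym (strictlyInverseʳ E _)) (cong (from E) eq))
      swap : ∀ a b c → a + b + c ≡ c + b + a
      swap = solve-∀

  module _ (E : Fin N ↔ X) where

    ∑-zero : {f : X → ℤ} → (∀ x → f x ≡ 0ℤ) → ∑ E f ≡ 0ℤ
    ∑-zero f≗0 = trans (∑-cong E f≗0) (trans (∑-const E 0ℤ) (*-zeroʳ (+ N)))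

    ∑-single : (z : X) {f : X → ℤ} → (∀ x → x ≢ z → f x ≡ 0ℤ) → ∑ E f ≡ f z
    ∑-single z {f} f≗0 = begin
      ∑ E f                     ≡⟨ +-identityʳ _ ⟨
      ∑ E f + 0ℤ                ≡⟨ ∑-except E z f≗0 ⟩
      ∑ E (λ _ → 0ℤ) + f z      ≡⟨ cong (_+ f z) (∑-zero (λ _ → refl)) ⟩
      0ℤ + f z                  ≡⟨ +-identityˡ _ ⟩
      f z                       ∎
      where open ≡-Reasoning

  indicator : Bool → ℤ
  indicator true  = 1ℤ
  indicator false = 0ℤ

  module _ (E : Fin N ↔ X) where

    δ : X → X → ℤ
    δ x y = indicator (does (≟-finite E x y))

    δ-≡ : ∀ {x y} → x ≡ y → δ x y ≡ 1ℤ
    δ-≡ {x} {y} x≡y = cong indicator (dec-true (≟-finite E x y) x≡y)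

    δ-≢ : ∀ {x y} → x ≢ y → δ x y ≡ 0ℤ
    δ-≢ {x} {y} x≢y = cong indicator (dec-false (≟-finite E x y) x≢y)

    ∑-δ : ∀ (f : X → ℤ) y → ∑ E (λ x → δ x y * f x) ≡ f y
    ∑-δ f y = begin
      ∑ E (λ x → δ x y * f x)  ≡⟨ ∑-single E y (λ x x≢y → cong (_* f x) (δ-≢ x≢y)) ⟩
      δ y y * f y              ≡⟨ cong (_* f y) (δ-≡ refl) ⟩
      1ℤ * f y                 ≡⟨ *-identityˡ (f y) ⟩
      f y                      ∎
      where open ≡-Reasoning

    -- The factor in front of `f x` counts the parameter pairs that `g` sends to `x`. Where this
    -- count is known, a sum over points becomes a sum over a parametrised spread or plane.
    ∑-image₂ : ∀ {M₁ M₂ : ℕ} {Y₁ Y₂ : Set} (H₁ : Fin M₁ ↔ Y₁) (H₂ : Fin M₂ ↔ Y₂) (g : Y₁ → Y₂ → X) (f : X → ℤ) →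
              ∑ E (λ x → ∑ H₁ (λ s → ∑ H₂ (λ t → δ x (g s t))) * f x) ≡ ∑ H₁ (λ s → ∑ H₂ (λ t → f (g s t)))
    ∑-image₂ H₁ H₂ g f = begin
      ∑ E (λ x → ∑ H₁ (λ s → ∑ H₂ (λ t → δ x (g s t))) * f x)
        ≡⟨ ∑-cong E (λ x → trans (sym (∑-*ʳ H₁ (f x) _)) (∑-cong H₁ (λ s → sym (∑-*ʳ H₂ (f x) _)))) ⟩
      ∑ E (λ x → ∑ H₁ (λ s → ∑ H₂ (λ t → δ x (g s t) * f x)))
        ≡⟨ ∑-swap E H₁ _ ⟩
      ∑ H₁ (λ s → ∑ E (λ x → ∑ H₂ (λ t → δ x (g s t) * f x)))
        ≡⟨ ∑-cong H₁ (λ s → trans (∑-swap E H₂ _) (∑-cong H₂ (λ t → ∑-δ f (g s t)))) ⟩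
      ∑ H₁ (λ s → ∑ H₂ (λ t → f (g s t))) ∎
      where
      open ≡-Reasoning

  square-parity-+ : ∀ k → ∃[ j ] (+ k * + k ≡ + k + + 2 * j)
  square-parity-+ zero    = 0ℤ , refl
  square-parity-+ (suc k) with j , eq ← square-parity-+ k = j + + k , (begin
    (1ℤ + + k) * (1ℤ + + k)     ≡⟨ expand (+ k) ⟩
    1ℤ + + k + + k + + k * + k  ≡⟨ cong (λ c → 1ℤ + + k + + k + c) eq ⟩
    1ℤ + + k + + k + (+ k + + 2 * j)  ≡⟨ collect (+ k) j ⟩
    1ℤ + + k + + 2 * (j + + k)  ∎)
    where
    open ≡-Reasoning
    expand : ∀ k → (1ℤ + k) * (1ℤ + k) ≡ 1ℤ + k + k + k * k
    expand = solve-∀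
    collect : ∀ k j → 1ℤ + k + k + (k + + 2 * j) ≡ 1ℤ + k + + 2 * (j + k)
    collect = solve-∀

  -- The witness is kept as data because it is later summed over all points.
  square-parity : ∀ i → ∃[ j ] (i * i ≡ i + + 2 * j)
  square-parity (+ k)      = square-parity-+ k
  -- `-[1+ k ]` has the same square as `+ suc k` by computation; replacing the linear term by its
  -- negative raises the witness by `+ suc k`.
  square-parity (-[1+ k ]) with j , eq ← square-parity-+ (suc k) = j + + suc k , trans eq (negate (+ suc k) j)
    where
    negate : ∀ k j → k + + 2 * j ≡ - k + + 2 * (j + k)
    negate = solve-∀

  -- This is the geometric sum q^k = 1 + (q - 1) [k], multiplied by q. At k = n - 1 it expresses the
  -- number of points through [n-1].
  ^-gaussNum : ∀ q k → + (q ℕ.^ suc k) ≡ + q + + q * ((+ q - 1ℤ) * + gaussNum q k)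
  ^-gaussNum q zero    = trans (cong +_ (ℕₚ.*-identityʳ q)) (expand (+ q))
    where
    expand : ∀ q → q ≡ q + q * ((q - 1ℤ) * 0ℤ)
    expand = solve-∀
  ^-gaussNum q (suc k) = begin
    + (q ℕ.^ suc (suc k))                               ≡⟨ pos-* q (q ℕ.^ suc k) ⟩
    + q * + (q ℕ.^ suc k)                               ≡⟨ cong (λ c → + q * c) (^-gaussNum q k) ⟩
    + q * (+ q + + q * ((+ q - 1ℤ) * + g))              ≡⟨ expand (+ q) (+ g) ⟩
    + q + + q * ((+ q - 1ℤ) * (1ℤ + + q * + g))         ≡⟨ cong (λ c → + q + + q * ((+ q - 1ℤ) * (1ℤ + c))) (pos-* q g) ⟨
    + q + + q * ((+ q - 1ℤ) * + (1 ℕ.+ q ℕ.* g))        ≡⟨ cong (λ c → + q + + q * ((+ q - 1ℤ) * + c)) (gaussNum-suc q k) ⟨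
    + q + + q * ((+ q - 1ℤ) * + gaussNum q (suc k))     ∎
    where
    open ≡-Reasoning
    g = gaussNum q k
    expand : ∀ q g → q * (q + q * ((q - 1ℤ) * g)) ≡ q + q * ((q - 1ℤ) * (1ℤ + q * g))
    expand = solve-∀

  -- Truncated subtraction does no harm, since at x = 0 the other factor vanishes.
  pos-x*[x∸1] : ∀ x → + (x ℕ.* (x ℕ.∸ 1)) ≡ + x * + x - + x
  pos-x*[x∸1] zero    = refl
  pos-x*[x∸1] (suc x) = trans (pos-* (suc x) x) (expand (+ x))
    where
    expand : ∀ x → (1ℤ + x) * x ≡ (1ℤ + x) * (1ℤ + x) - (1ℤ + x)
    expand = solve-∀

-- Vector algebra over a finite field.

map-distribˡ-zipWith : ∀ {A : Set} {n} {f : A → A} {g : A → A → A} → (∀ a b → f (g a b) ≡ g (f a) (f b)) →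
                       (u v : Vec A n) → map f (zipWith g u v) ≡ zipWith g (map f u) (map f v)
map-distribˡ-zipWith eq []      []      = refl
map-distribˡ-zipWith eq (a ∷ u) (b ∷ v) = cong₂ _∷_ (eq a b) (map-distribˡ-zipWith eq u v)

map-distribʳ-zipWith : ∀ {A : Set} {n} {f f₁ f₂ : A → A} {g : A → A → A} → (∀ a → f a ≡ g (f₁ a) (f₂ a)) →
                       (u : Vec A n) → map f u ≡ zipWith g (map f₁ u) (map f₂ u)
map-distribʳ-zipWith eq []      = refl
map-distribʳ-zipWith eq (a ∷ u) = cong₂ _∷_ (eq a) (map-distribʳ-zipWith eq u)

does-true : ∀ {A : Set} (a? : Dec A) → does a? ≡ true → A
does-true (yes a) _ = a

module AffineGeometry {q : ℕ} (F : FiniteField q) (n : ℕ) where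
  open FiniteField F public
    using (0#; 1#; isCommutativeRing; 0≢1; inverse; enumeration)
    renaming (Carrier to K; _+_ to _+ᴷ_; _*_ to _*ᴷ_; -_ to -ᴷ_)
  open AffineSpace F n public

  private
    module R = IsCommutativeRing isCommutativeRing
    K-ring : CommutativeRing 0ℓ 0ℓ
    K-ring = record { isCommutativeRing = isCommutativeRing }
    module Rₚ = GroupProperties (CommutativeRing.+-group K-ring)

  points : Fin (q ℕ.^ n) ↔ Point
  points = vec-enum enumeration n

  _≟ᴷ_ : DecidableEquality K
  _≟ᴷ_ = ≟-finite enumeration

  _≟ᵛ_ : DecidableEquality Point
  _≟ᵛ_ = ≟-finite points

  ⊕-assoc : ∀ u v w → (u ⊕ v) ⊕ w ≡ u ⊕ (v ⊕ w)
  ⊕-assoc = zipWith-assoc R.+-assoc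

  ⊕-comm : ∀ u v → u ⊕ v ≡ v ⊕ u
  ⊕-comm = zipWith-comm R.+-comm

  ⊕-identityˡ : ∀ u → zeroVec ⊕ u ≡ u
  ⊕-identityˡ = zipWith-identityˡ R.+-identityˡ

  ⊕-identityʳ : ∀ u → u ⊕ zeroVec ≡ u
  ⊕-identityʳ = zipWith-identityʳ R.+-identityʳ

  ⊕-exchange : ∀ u v w → (u ⊕ v) ⊕ w ≡ (u ⊕ w) ⊕ v
  ⊕-exchange u v w = trans (⊕-assoc u v w) (trans (cong (u ⊕_) (⊕-comm v w)) (sym (⊕-assoc u w v)))

  ·-distribˡ : ∀ t u v → t · (u ⊕ v) ≡ (t · u) ⊕ (t · v)
  ·-distribˡ t = map-distribˡ-zipWith (R.distribˡ t)

  ·-distribʳ : ∀ s t u → (s +ᴷ t) · u ≡ (s · u) ⊕ (t · u)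
  ·-distribʳ s t = map-distribʳ-zipWith (λ a → R.distribʳ a s t)

  ·-assoc : ∀ s t u → (s *ᴷ t) · u ≡ s · (t · u)
  ·-assoc s t u = trans (map-cong (R.*-assoc s t) u) (map-∘ (s *ᴷ_) (t *ᴷ_) u)

  ·-identity : ∀ u → 1# · u ≡ u
  ·-identity u = trans (map-cong R.*-identityˡ u) (map-id u)

  ·-zeroˡ : ∀ u → 0# · u ≡ zeroVec
  ·-zeroˡ u = trans (map-cong R.zeroˡ u) (map-const u 0#)

  ·-zeroʳ : ∀ t → t · zeroVec ≡ zeroVec
  ·-zeroʳ t = trans (map-replicate (t *ᴷ_) 0# n) (cong (replicate n) (R.zeroʳ t))

  ⊕-· : ∀ p s t d → (p ⊕ (s · d)) ⊕ (t · d) ≡ p ⊕ ((s +ᴷ t) · d)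
  ⊕-· p s t d = trans (⊕-assoc p _ _) (cong (p ⊕_) (sym (·-distribʳ s t d)))

  ⊕-0· : ∀ p d → p ⊕ (0# · d) ≡ p
  ⊕-0· p d = trans (cong (p ⊕_) (·-zeroˡ d)) (⊕-identityʳ p)

  ⊕-·-inverseʳ : ∀ p t d → (p ⊕ (t · d)) ⊕ ((-ᴷ t) · d) ≡ p
  ⊕-·-inverseʳ p t d = trans (⊕-· p t (-ᴷ t) d)
    (trans (cong (λ s → p ⊕ (s · d)) (R.-‿inverseʳ t)) (⊕-0· p d))

  ⊕-·-inverseˡ : ∀ p t d → (p ⊕ ((-ᴷ t) · d)) ⊕ (t · d) ≡ p
  ⊕-·-inverseˡ p t d = trans (⊕-· p (-ᴷ t) t d)
    (trans (cong (λ s → p ⊕ (s · d)) (R.-‿inverseˡ t)) (⊕-0· p d))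

  cancel-· : ∀ {t d} → ¬ t ≡ 0# → t · d ≡ zeroVec → d ≡ zeroVec
  cancel-· {t} {d} t≢0 td≡0 with b , tb≡1 ← inverse t t≢0 = begin
    d                ≡⟨ ·-identity d ⟨
    1# · d           ≡⟨ cong (_· d) tb≡1 ⟨
    (t *ᴷ b) · d     ≡⟨ cong (_· d) (R.*-comm t b) ⟩
    (b *ᴷ t) · d     ≡⟨ ·-assoc b t d ⟩
    b · (t · d)      ≡⟨ cong (b ·_) td≡0 ⟩
    b · zeroVec      ≡⟨ ·-zeroʳ b ⟩
    zeroVec          ∎
    where open ≡-Reasoning

  ⊕-cancelˡ : ∀ p {u v} → p ⊕ u ≡ p ⊕ v → u ≡ v
  ⊕-cancelˡ p {u} {v} eq = trans (sym (drop u)) (trans (cong (((-ᴷ 1#) · p) ⊕_) eq) (drop v))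
    where
    drop : ∀ w → ((-ᴷ 1#) · p) ⊕ (p ⊕ w) ≡ w
    drop w = begin
      ((-ᴷ 1#) · p) ⊕ (p ⊕ w)          ≡⟨ ⊕-assoc _ p w ⟨
      (((-ᴷ 1#) · p) ⊕ p) ⊕ w          ≡⟨ cong (λ z → (((-ᴷ 1#) · p) ⊕ z) ⊕ w) (·-identity p) ⟨
      (((-ᴷ 1#) · p) ⊕ (1# · p)) ⊕ w   ≡⟨ cong (_⊕ w) (·-distribʳ (-ᴷ 1#) 1# p) ⟨
      (((-ᴷ 1#) +ᴷ 1#) · p) ⊕ w        ≡⟨ cong (λ c → (c · p) ⊕ w) (R.-‿inverseˡ 1#) ⟩
      (0# · p) ⊕ w                     ≡⟨ cong (_⊕ w) (·-zeroˡ p) ⟩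
      zeroVec ⊕ w                      ≡⟨ ⊕-identityˡ w ⟩
      w                                ∎
      where open ≡-Reasoning

  ·-injective : ∀ {d s t} → ¬ d ≡ zeroVec → ∀ p → p ⊕ (s · d) ≡ p ⊕ (t · d) → s ≡ t
  ·-injective {d} {s} {t} d≢0 p eq with (s +ᴷ (-ᴷ t)) ≟ᴷ 0#
  ... | yes s-t≡0 = Rₚ.x∙y⁻¹≈ε⇒x≈y s t s-t≡0
  ... | no  s-t≢0 = contradiction (cancel-· s-t≢0 (⊕-cancelˡ p (begin
    p ⊕ ((s +ᴷ (-ᴷ t)) · d)           ≡⟨ ⊕-· p s (-ᴷ t) d ⟨
    (p ⊕ (s · d)) ⊕ ((-ᴷ t) · d)      ≡⟨ cong (_⊕ ((-ᴷ t) · d)) eq ⟩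
    (p ⊕ (t · d)) ⊕ ((-ᴷ t) · d)      ≡⟨ ⊕-·-inverseʳ p t d ⟩
    p                                 ≡⟨ ⊕-identityʳ p ⟨
    p ⊕ zeroVec                       ∎))) d≢0
    where open ≡-Reasoning

  Independent : Point → Point → Set
  Independent d e = ¬ d ≡ zeroVec × (∀ c → ¬ e ≡ c · d)

  -- If t and t′ differ, dividing (t′ - t) e = (s - s′) d by t′ - t makes `e` a multiple of `d`. If
  -- they agree, the claim reduces to injectivity along a line.
  plane-injective : ∀ {d e s s′ t t′} → Independent d e → ∀ p →
                    (p ⊕ (s · d)) ⊕ (t · e) ≡ (p ⊕ (s′ · d)) ⊕ (t′ · e) → s ≡ s′ × t ≡ t′
  plane-injective {d} {e} {s} {s′} {t} {t′} (d≢0 , e∉⟨d⟩) p eq with (t′ +ᴷ (-ᴷ t)) ≟ᴷ 0#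
  ... | yes t′-t≡0 = ·-injective d≢0 p s-eq , sym t′≡t
    where
    open ≡-Reasoning
    t′≡t : t′ ≡ t
    t′≡t = Rₚ.x∙y⁻¹≈ε⇒x≈y t′ t t′-t≡0
    s-eq : p ⊕ (s · d) ≡ p ⊕ (s′ · d)
    s-eq = begin
      p ⊕ (s · d)                                    ≡⟨ ⊕-·-inverseʳ _ t e ⟨
      ((p ⊕ (s · d)) ⊕ (t · e)) ⊕ ((-ᴷ t) · e)       ≡⟨ cong (_⊕ ((-ᴷ t) · e)) eq ⟩
      ((p ⊕ (s′ · d)) ⊕ (t′ · e)) ⊕ ((-ᴷ t) · e)     ≡⟨ cong (λ r → ((p ⊕ (s′ · d)) ⊕ (r · e)) ⊕ ((-ᴷ t) · e)) t′≡t ⟩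
      ((p ⊕ (s′ · d)) ⊕ (t · e)) ⊕ ((-ᴷ t) · e)      ≡⟨ ⊕-·-inverseʳ _ t e ⟩
      p ⊕ (s′ · d)                                   ∎
  ... | no t′-t≢0 with b , rb≡1 ← inverse _ t′-t≢0 = contradiction e≡ (e∉⟨d⟩ _)
    where
    open ≡-Reasoning
    r = t′ +ᴷ (-ᴷ t)
    sd≡ : s · d ≡ (s′ · d) ⊕ (r · e)
    sd≡ = ⊕-cancelˡ p (begin
      p ⊕ (s · d)                                    ≡⟨ ⊕-·-inverseʳ _ t e ⟨
      ((p ⊕ (s · d)) ⊕ (t · e)) ⊕ ((-ᴷ t) · e)       ≡⟨ cong (_⊕ ((-ᴷ t) · e)) eq ⟩
      ((p ⊕ (s′ · d)) ⊕ (t′ · e)) ⊕ ((-ᴷ t) · e)     ≡⟨ ⊕-· _ t′ (-ᴷ t) e ⟩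
      (p ⊕ (s′ · d)) ⊕ (r · e)                       ≡⟨ ⊕-assoc p _ _ ⟩
      p ⊕ ((s′ · d) ⊕ (r · e))                       ∎)
    re≡ : r · e ≡ ((-ᴷ s′) +ᴷ s) · d
    re≡ = begin
      r · e                                          ≡⟨ ⊕-·-inverseʳ (r · e) s′ d ⟨
      ((r · e) ⊕ (s′ · d)) ⊕ ((-ᴷ s′) · d)           ≡⟨ cong (_⊕ ((-ᴷ s′) · d)) (⊕-comm _ _) ⟩
      ((s′ · d) ⊕ (r · e)) ⊕ ((-ᴷ s′) · d)           ≡⟨ cong (_⊕ ((-ᴷ s′) · d)) sd≡ ⟨
      (s · d) ⊕ ((-ᴷ s′) · d)                        ≡⟨ ⊕-comm _ _ ⟩
      ((-ᴷ s′) · d) ⊕ (s · d)                        ≡⟨ ·-distribʳ (-ᴷ s′) s d ⟨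
      ((-ᴷ s′) +ᴷ s) · d                             ∎
    e≡ : e ≡ (b *ᴷ ((-ᴷ s′) +ᴷ s)) · d
    e≡ = begin
      e                                  ≡⟨ ·-identity e ⟨
      1# · e                             ≡⟨ cong (_· e) (trans (R.*-comm b r) rb≡1) ⟨
      (b *ᴷ r) · e                       ≡⟨ ·-assoc b r e ⟩
      b · (r · e)                        ≡⟨ cong (b ·_) re≡ ⟩
      b · (((-ᴷ s′) +ᴷ s) · d)           ≡⟨ ·-assoc b _ d ⟨
      (b *ᴷ ((-ᴷ s′) +ᴷ s)) · d          ∎

  -- Lines, and spreads given by direction fields.

  _∈⟨_,_⟩ : Point → Point → Point → Set
  y ∈⟨ p , d ⟩ = ∃[ t ] (y ≡ p ⊕ (t · d))

  base∈ : ∀ p d → p ∈⟨ p , d ⟩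
  base∈ p d = 0# , sym (⊕-0· p d)

  ∈⟨⟩-sym : ∀ {p d y} → y ∈⟨ p , d ⟩ → p ∈⟨ y , d ⟩
  ∈⟨⟩-sym {p} {d} (t , refl) = (-ᴷ t) , sym (⊕-·-inverseʳ p t d)

  ∈⟨⟩-trans : ∀ {p d y z} → y ∈⟨ p , d ⟩ → z ∈⟨ y , d ⟩ → z ∈⟨ p , d ⟩
  ∈⟨⟩-trans {p} {d} (s , refl) (t , refl) = (s +ᴷ t) , ⊕-· p s t d

  ∈⟨⟩? : ∀ p d y → Dec (y ∈⟨ p , d ⟩)
  ∈⟨⟩? p d y = any-finite? enumeration (λ t → y ≟ᵛ (p ⊕ (t · d)))

  line : ∀ p d → ¬ d ≡ zeroVec → Line
  line p d d≢0 = record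
    { pts    = λ y → does (∈⟨⟩? p d y)
    ; base   = p
    ; dir    = d
    ; dir≢0  = d≢0
    ; isLine = λ y → does-true (∈⟨⟩? p d y) , dec-true (∈⟨⟩? p d y)
    }

  SamePoints : Line → Line → Set
  SamePoints ℓ ℓ′ = ∀ y → (y ∈ᴸ ℓ → y ∈ᴸ ℓ′) × (y ∈ᴸ ℓ′ → y ∈ᴸ ℓ)

  -- A `Line` also records a base and a direction, so different terms can have the same points.
  -- Being a spread depends on the points alone.
  replace-head : ∀ {ℓ ℓ′ S} → SamePoints ℓ ℓ′ → IsLineSpread (ℓ ∷ S) → IsLineSpread (ℓ′ ∷ S)
  replace-head {ℓ} {ℓ′} {S} same spread y =
    (proj₁ covered , fwd (proj₁ covered) (proj₂ covered)) ,
    (λ i j y∈i y∈j → proj₂ (spread y) i j (bwd i y∈i) (bwd j y∈j))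
    where
    covered = proj₁ (spread y)
    fwd : ∀ i → y ∈ᴸ lookup (ℓ ∷ S) i → y ∈ᴸ lookup (ℓ′ ∷ S) i
    fwd zero    = proj₁ (same y)
    fwd (suc i) y∈ = y∈
    bwd : ∀ i → y ∈ᴸ lookup (ℓ′ ∷ S) i → y ∈ᴸ lookup (ℓ ∷ S) i
    bwd zero    = proj₂ (same y)
    bwd (suc i) y∈ = y∈

  Disjoint : Line → Line → Set
  Disjoint ℓ ℓ′ = ∀ y → y ∈ᴸ ℓ → ¬ y ∈ᴸ ℓ′

  disjoint-cover⇒spread : ∀ {S} → (∀ y → Any (y ∈ᴸ_) S) → AllPairs Disjoint S → IsLineSpread S
  disjoint-cover⇒spread {S} cover disjoint y =
    (Any.index (cover y) , Anyₚ.lookup-index (cover y)) , unique disjoint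
    where
    unique : ∀ {S} → AllPairs Disjoint S → ∀ i j → y ∈ᴸ lookup S i → y ∈ᴸ lookup S j → i ≡ j
    unique (_ ∷ _)  zero    zero    _  _   = refl
    unique (d ∷ _)  zero    (suc j) y∈ y∈′ = contradiction y∈′ (All.lookup d (∈-lookup j) y y∈)
    unique (d ∷ _)  (suc i) zero    y∈ y∈′ = contradiction y∈ (All.lookup d (∈-lookup i) y y∈′)
    unique (_ ∷ ds) (suc i) (suc j) y∈ y∈′ = cong suc (unique ds i j y∈ y∈′)

  record DirectionField : Set where
    field
      direction   : Point → Point
      direction≢0 : ∀ p → ¬ direction p ≡ zeroVec
      invariant   : ∀ p t → direction (p ⊕ (t · direction p)) ≡ direction p

    _∼_ : Point → Point → Set
    p ∼ y = y ∈⟨ p , direction p ⟩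

    ∼⇒≡ : ∀ {p y} → p ∼ y → direction y ≡ direction p
    ∼⇒≡ {p} (t , refl) = invariant p t

    ∼-decSetoid : DecSetoid 0ℓ 0ℓ
    ∼-decSetoid = record
      { Carrier = Point
      ; _≈_ = _∼_
      ; isDecEquivalence = record
        { isEquivalence = record
          { refl  = λ {p} → base∈ p _
          ; sym   = λ {p} {y} p∼y → subst (p ∈⟨ y ,_⟩) (sym (∼⇒≡ p∼y)) (∈⟨⟩-sym p∼y)
          ; trans = λ {p} {y} {z} p∼y y∼z → ∈⟨⟩-trans p∼y (subst (z ∈⟨ y ,_⟩) (∼⇒≡ p∼y) y∼z)
          }
        ; _≟_ = λ p → ∈⟨⟩? p (direction p)
        }
      }
    open DecSetoid ∼-decSetoid public using () renaming (_≟_ to _∼?_; sym to ∼-sym; trans to ∼-trans)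

    lineThrough : Point → Line
    lineThrough p = line p (direction p) (direction≢0 p)

    private
      candidates : Point → List Point
      candidates p = p ∷ List.tabulate (to points)

    -- This is the tail that `deduplicate` computes on `candidates p`, so that
    -- `p ∷ otherRepresentatives p` is by definition the deduplicated list.
    otherRepresentatives : Point → List Point
    otherRepresentatives p = List.filter (λ y → ¬? (p ∼? y)) (deduplicate _∼?_ (List.tabulate (to points)))

    -- Putting p first makes a prescribed line the head of the spread, where it can be exchanged.
    spread : Point → List Line
    spread p = List.map lineThrough (p ∷ otherRepresentatives p)

    -- Deduplication keeps a representative of every class, which gives the covering, and leaves
    -- pairwise inequivalent ones, which gives disjointness.
    spread-isLineSpread : ∀ p → IsLineSpread (spread p)
    spread-isLineSpread p = disjoint-cover⇒spread
      (λ y → Anyₚ.map⁺ (Any.map (λ {r} → proj₂ (isLine (lineThrough r) y))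
        (Anyₚ.deduplicate⁺ _∼?_ ∼-trans (represented y))))
      (AllPairsₚ.map⁺ (AllPairs.map
        (λ {r} {r′} r≁r′ y y∈r y∈r′ → r≁r′ (∼-trans (proj₁ (isLine (lineThrough r) y) y∈r)
          (∼-sym (proj₁ (isLine (lineThrough r′) y) y∈r′))))
        (deduplicate-! ∼-decSetoid (candidates p))))
      where
      represented : ∀ y → Any (_∼ y) (candidates p)
      represented y = there (Anyₚ.tabulate⁺ (from points y)
        (subst (_∼ y) (sym (strictlyInverseˡ points y)) (base∈ y _)))

-- The indicator of a line class and its sums over spreads.

module CameronLiebler {q : ℕ} (F : FiniteField q) (n : ℕ) (𝓛 : AffineSpace.LineSet F n) (x : ℕ)
                      (cameronLiebler : AffineSpace.IsCameronLieblerLineClass F n 𝓛 x) where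
  open IntegerSums
  open AffineGeometry F n
  open ≡-Reasoning

  private
    module R = IsCommutativeRing isCommutativeRing

    v : ℤ
    v = + (q ℕ.^ n)

  ∑ᴷ : (K → ℤ) → ℤ
  ∑ᴷ = ∑ enumeration

  ∑ᴾ : (Point → ℤ) → ℤ
  ∑ᴾ = ∑ points

  𝟙 : Line → ℤ
  𝟙 ℓ = indicator (𝓛 ℓ)

  ∣∩∣-∷ : ∀ ℓ S → + ∣ 𝓛 ∩ ℓ ∷ S ∣ ≡ 𝟙 ℓ + (+ ∣ 𝓛 ∩ S ∣)
  ∣∩∣-∷ ℓ S with 𝓛 ℓ
  ... | true  = refl
  ... | false = refl

  opaque
    unfolding ∑

    ∣∩∣-∑ : ∀ S → + ∣ 𝓛 ∩ S ∣ ≡ ∑ (↔-id _) (λ i → 𝟙 (lookup S i))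
    ∣∩∣-∑ []      = refl
    ∣∩∣-∑ (ℓ ∷ S) = trans (∣∩∣-∷ ℓ S) (cong (λ c → 𝟙 ℓ + c) (∣∩∣-∑ S))

  constantField : ∀ d → ¬ d ≡ zeroVec → DirectionField
  constantField d d≢0 = record
    { direction = λ _ → d ; direction≢0 = λ _ → d≢0 ; invariant = λ _ _ → refl }

  -- The value 0 at the zero vector lets sums over directions run over all vectors.
  χ : Point → Point → ℤ
  χ p d with d ≟ᵛ zeroVec
  ... | yes _   = 0ℤ
  ... | no  d≢0 = 𝟙 (line p d d≢0)

  χ-zero : ∀ p {d} → d ≡ zeroVec → χ p d ≡ 0ℤ
  χ-zero p {d} d≡0 with d ≟ᵛ zeroVec
  ... | yes _   = refl
  ... | no  d≢0 = contradiction d≡0 d≢0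

  -- Exchanging one description of a line for another within a spread shows that 𝓛
  -- depends only on the point sets of lines.
  χ-line : ∀ {p d} ℓ → ¬ d ≡ zeroVec →
           (∀ y → (y ∈ᴸ ℓ → y ∈⟨ p , d ⟩) × (y ∈⟨ p , d ⟩ → y ∈ᴸ ℓ)) → 𝟙 ℓ ≡ χ p d
  χ-line {p} {d} ℓ d≢0 same with d ≟ᵛ zeroVec
  ... | yes d≡0 = contradiction d≡0 d≢0
  ... | no  d≢0 = +-cancelʳ (+ ∣ 𝓛 ∩ rest ∣) (𝟙 ℓ) (𝟙 ℓ′) (begin
    𝟙 ℓ + (+ ∣ 𝓛 ∩ rest ∣)      ≡⟨ ∣∩∣-∷ ℓ rest ⟨
    + ∣ 𝓛 ∩ ℓ ∷ rest ∣            ≡⟨ cong (λ c → + c) (cameronLiebler (ℓ ∷ rest) (replace-head ℓ′~ℓ spread′)) ⟩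
    + x                           ≡⟨ cong (λ c → + c) (cameronLiebler (ℓ′ ∷ rest) spread′) ⟨
    + ∣ 𝓛 ∩ ℓ′ ∷ rest ∣           ≡⟨ ∣∩∣-∷ ℓ′ rest ⟩
    𝟙 ℓ′ + (+ ∣ 𝓛 ∩ rest ∣)     ∎)
    where
    open DirectionField (constantField d d≢0)
    ℓ′ = line p d d≢0
    rest = List.map lineThrough (otherRepresentatives p)
    spread′ : IsLineSpread (ℓ′ ∷ rest)
    spread′ = spread-isLineSpread p
    ℓ′~ℓ : SamePoints ℓ′ ℓ
    ℓ′~ℓ y = proj₂ (same y) ∘ proj₁ (isLine ℓ′ y) , proj₂ (isLine ℓ′ y) ∘ proj₁ (same y)

  χ-≢0 : ∀ p {d} (d≢0 : ¬ d ≡ zeroVec) → χ p d ≡ 𝟙 (line p d d≢0)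
  χ-≢0 p d≢0 = sym (χ-line _ d≢0 (isLine (line p _ d≢0)))

  χ-shift : ∀ p t d → χ (p ⊕ (t · d)) d ≡ χ p d
  χ-shift p t d = go (d ≟ᵛ zeroVec)
    where
    p′ = p ⊕ (t · d)
    go : Dec (d ≡ zeroVec) → χ p′ d ≡ χ p d
    go (yes d≡0) = trans (χ-zero p′ d≡0) (sym (χ-zero p d≡0))
    go (no  d≢0) = trans (χ-≢0 p′ d≢0) (χ-line ℓ d≢0 (λ y →
      ∈⟨⟩-trans (t , refl) ∘ proj₁ (isLine ℓ y) ,
      proj₂ (isLine ℓ y) ∘ ∈⟨⟩-trans (∈⟨⟩-sym (t , refl))))
      where ℓ = line p′ d d≢0

  χ-scale : ∀ p {c} d → ¬ c ≡ 0# → χ p (c · d) ≡ χ p d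
  χ-scale p {c} d c≢0 = go (d ≟ᵛ zeroVec)
    where
    go : Dec (d ≡ zeroVec) → χ p (c · d) ≡ χ p d
    go (yes d≡0) = trans (χ-zero p (trans (cong (c ·_) d≡0) (·-zeroʳ c))) (sym (χ-zero p d≡0))
    go (no  d≢0) with b , cb≡1 ← inverse c c≢0 =
      trans (χ-≢0 p cd≢0) (χ-line ℓ d≢0 (λ y →
        (λ (t , eq) → t *ᴷ c , trans eq (cong (p ⊕_) (sym (·-assoc t c d)))) ∘ proj₁ (isLine ℓ y) ,
        proj₂ (isLine ℓ y) ∘ λ (t , eq) → t *ᴷ b , trans eq (cong (p ⊕_) (sym (begin
          (t *ᴷ b) · (c · d)   ≡⟨ ·-assoc t b _ ⟩
          t · (b · (c · d))    ≡⟨ cong (t ·_) (·-assoc b c d) ⟨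
          t · ((b *ᴷ c) · d)   ≡⟨ cong (λ r → t · (r · d)) (trans (R.*-comm b c) cb≡1) ⟩
          t · (1# · d)         ≡⟨ cong (t ·_) (·-identity d) ⟩
          t · d                ∎)))))
      where
      cd≢0 : ¬ c · d ≡ zeroVec
      cd≢0 cd≡0 = d≢0 (cancel-· c≢0 cd≡0)
      ℓ = line p (c · d) cd≢0

  χ-idem : ∀ p d → χ p d * χ p d ≡ χ p d
  χ-idem p d with d ≟ᵛ zeroVec
  ... | yes _   = refl
  ... | no  d≢0 with 𝓛 (line p d d≢0)
  ...   | true  = refl
  ...   | false = refl

  -- The parametrised lines of a spread meet every point once: the line is unique by the spread
  -- condition, the parameter because the direction is nonzero.
  ∑-spread : ∀ S → IsLineSpread S → (f : Point → ℤ) →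
             ∑ᴾ f ≡ ∑ (↔-id _) (λ i → ∑ᴷ (λ t → f (base (lookup S i) ⊕ (t · dir (lookup S i)))))
  ∑-spread S spread f = begin
    ∑ᴾ f                               ≡⟨ ∑-cong points (λ y → sym (trans (cong (_* f y) (once y)) (*-identityˡ (f y)))) ⟩
    ∑ᴾ (λ y → multiplicity y * f y)    ≡⟨ ∑-image₂ points (↔-id _) enumeration pt f ⟩
    ∑ (↔-id _) (λ i → ∑ᴷ (λ t → f (pt i t)))  ∎
    where
    pt : Fin (List.length S) → K → Point
    pt i t = base (lookup S i) ⊕ (t · dir (lookup S i))
    multiplicity : Point → ℤ
    multiplicity y = ∑ (↔-id _) (λ i → ∑ᴷ (λ t → δ points y (pt i t)))
    once : ∀ y → multiplicity y ≡ 1ℤ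
    once y with (i , y∈i) , unique ← spread y with t , y≡ ← proj₁ (isLine (lookup S i) y) y∈i =
      trans (∑-single (↔-id _) i (λ j j≢i → ∑-zero enumeration (λ s → δ-≢ points
              (λ y≡′ → j≢i (unique j i (proj₂ (isLine (lookup S j) y) (s , y≡′)) y∈i)))))
      (trans (∑-single enumeration t (λ s s≢t → δ-≢ points
              (λ y≡′ → s≢t (·-injective (dir≢0 (lookup S i)) _ (trans (sym y≡′) y≡)))))
      (δ-≡ points y≡))

  -- The spread of `D` contains x lines of `𝓛`, and each is counted once for each of its q points.
  ∑-directionField : (D : DirectionField) → ∑ᴾ (λ y → χ y (DirectionField.direction D y)) ≡ + q * + x
  ∑-directionField D = begin
    ∑ᴾ (λ y → χ y (direction y))                       ≡⟨ ∑-spread S S-spread _ ⟩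
    ∑ᶠ (λ i → ∑ᴷ (λ t → χ (pt i t) (direction (pt i t)))) ≡⟨ ∑-cong (↔-id _) (λ i → trans (∑-cong enumeration (on-line i)) (∑-const enumeration _)) ⟩
    ∑ᶠ (λ i → + q * 𝟙 (lookup S i))                    ≡⟨ ∑-*ˡ (↔-id _) (+ q) _ ⟩
    + q * ∑ᶠ (λ i → 𝟙 (lookup S i))                    ≡⟨ cong (λ c → + q * c) (∣∩∣-∑ S) ⟨
    + q * + ∣ 𝓛 ∩ S ∣                                  ≡⟨ cong (λ c → + q * + c) (cameronLiebler S S-spread) ⟩
    + q * + x                                          ∎
    where
    open DirectionField D
    S = spread zeroVec
    S-spread = spread-isLineSpread zeroVec
    ∑ᶠ : (Fin (List.length S) → ℤ) → ℤ
    ∑ᶠ = ∑ (↔-id _)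
    pt : Fin (List.length S) → K → Point
    pt i t = base (lookup S i) ⊕ (t · dir (lookup S i))
    tangent : All (λ ℓ → dir ℓ ≡ direction (base ℓ)) S
    tangent = Allₚ.map⁺ (All.universal (λ _ → refl) _)
    on-line : ∀ i t → χ (pt i t) (direction (pt i t)) ≡ 𝟙 (lookup S i)
    on-line i t = begin
      χ (b ⊕ (t · d)) (direction (b ⊕ (t · d)))                         ≡⟨ cong (λ e → χ (b ⊕ (t · d)) (direction (b ⊕ (t · e)))) d≡ ⟩
      χ (b ⊕ (t · d)) (direction (b ⊕ (t · direction b)))               ≡⟨ cong (χ (b ⊕ (t · d))) (trans (invariant b t) (sym d≡)) ⟩
      χ (b ⊕ (t · d)) d                                                 ≡⟨ χ-shift b t d ⟩
      χ b d                                                             ≡⟨ χ-line ℓ (dir≢0 ℓ) (isLine ℓ) ⟨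
      𝟙 ℓ                                                               ∎
      where
      ℓ = lookup S i
      b = base ℓ
      d = dir ℓ
      d≡ : d ≡ direction b
      d≡ = All.lookup tangent (∈-lookup i)

  shift-points : K → Point → Point ↔ Point
  shift-points t d = mk↔ₛ′ (_⊕ (t · d)) (_⊕ ((-ᴷ t) · d)) (λ p → ⊕-·-inverseˡ p t d) (λ p → ⊕-·-inverseʳ p t d)

  ∑ᴾ-shift : ∀ (f : Point → ℤ) t d → ∑ᴾ (λ p → f (p ⊕ (t · d))) ≡ ∑ᴾ f
  ∑ᴾ-shift f t d = ∑-reindex points (shift-points t d) f

  ∑ᴾ-χ : ∀ {d} → ¬ d ≡ zeroVec → ∑ᴾ (λ p → χ p d) ≡ + q * + x
  ∑ᴾ-χ {d} d≢0 = ∑-directionField (constantField d d≢0)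

  -- For independent d and e, the number of lines of 𝓛 in direction e in the plane p + ⟨d, e⟩.
  parallel : Point → Point → Point → ℤ
  parallel p d e = ∑ᴷ (λ s → χ (p ⊕ (s · d)) e)

  ∑-parallel : ∀ p d e → ∑ᴷ (λ s → ∑ᴷ (λ t → χ ((p ⊕ (s · d)) ⊕ (t · e)) e)) ≡ + q * parallel p d e
  ∑-parallel p d e = begin
    ∑ᴷ (λ s → ∑ᴷ (λ t → χ ((p ⊕ (s · d)) ⊕ (t · e)) e))
      ≡⟨ ∑-cong enumeration (λ s → trans (∑-cong enumeration (λ t → χ-shift (p ⊕ (s · d)) t e)) (∑-const enumeration _)) ⟩
    ∑ᴷ (λ s → + q * χ (p ⊕ (s · d)) e)
      ≡⟨ ∑-*ˡ enumeration (+ q) _ ⟩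
    + q * parallel p d e ∎

  -- Turning the lines inside one plane.

  module PlaneSwitch (p d e : Point) (d≢0 : ¬ d ≡ zeroVec) (e≢0 : ¬ e ≡ zeroVec) (e∉⟨d⟩ : ∀ c → ¬ e ≡ c · d) where

    pt : K → K → Point
    pt s t = (p ⊕ (s · d)) ⊕ (t · e)

    InPlane : Point → Set
    InPlane y = ∃[ s ] ∃[ t ] (y ≡ pt s t)

    inPlane? : ∀ y → Dec (InPlane y)
    inPlane? y = any-finite? enumeration (λ s → any-finite? enumeration (λ t → y ≟ᵛ pt s t))

    InPlane-⊕e : ∀ {y} r → InPlane y → InPlane (y ⊕ (r · e))
    InPlane-⊕e r (s , t , refl) = s , t +ᴷ r , ⊕-· _ t r e

    InPlane-⊕d : ∀ {y} r → InPlane y → InPlane (y ⊕ (r · d))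
    InPlane-⊕d r (s , t , refl) = s +ᴷ r , t , trans (⊕-exchange _ _ _) (cong (_⊕ (t · e)) (⊕-· p s r d))

    select : ∀ {y} → Dec (InPlane y) → Point
    select (yes _) = e
    select (no _)  = d

    select-yes : ∀ {y} (y? : Dec (InPlane y)) → InPlane y → select y? ≡ e
    select-yes (yes _)  _  = refl
    select-yes (no y∉)  y∈ = contradiction y∈ y∉

    select-no : ∀ {y} (y? : Dec (InPlane y)) → ¬ InPlane y → select y? ≡ d
    select-no (yes y∈) y∉ = contradiction y∈ y∉
    select-no (no _)   _  = refl

    -- Lines in direction `e` inside the plane and in direction `d` outside. A line in direction `d`
    -- that starts outside stays outside, because translations along `d` preserve the plane.
    switched : DirectionField
    switched = record
      { direction   = λ y → select (inPlane? y)
      ; direction≢0 = λ y → select≢0 (inPlane? y)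
      ; invariant   = λ y t → invariant y t (inPlane? y)
      }
      where
      select≢0 : ∀ {y} (y? : Dec (InPlane y)) → ¬ select y? ≡ zeroVec
      select≢0 (yes _) = e≢0
      select≢0 (no _)  = d≢0
      invariant : ∀ y t (y? : Dec (InPlane y)) → select (inPlane? (y ⊕ (t · select y?))) ≡ select y?
      invariant y t (yes y∈) = select-yes (inPlane? _) (InPlane-⊕e t y∈)
      invariant y t (no y∉)  = select-no (inPlane? _)
        (λ y′∈ → y∉ (subst InPlane (⊕-·-inverseʳ y t d) (InPlane-⊕d (-ᴷ t) y′∈)))

    -- The characteristic function of the plane, written as a count of parameters to suit
    -- `∑-image₂`.
    multiplicity : Point → ℤ
    multiplicity y = ∑ᴷ (λ s → ∑ᴷ (λ t → δ points y (pt s t)))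

    multiplicity-in : ∀ {y} → InPlane y → multiplicity y ≡ 1ℤ
    multiplicity-in {y} (s , t , y≡) =
      trans (∑-single enumeration s (λ s′ s′≢s → ∑-zero enumeration (λ t′ → δ-≢ points
        (λ y≡′ → s′≢s (proj₁ (plane-injective (d≢0 , e∉⟨d⟩) p (trans (sym y≡′) y≡)))))))
      (trans (∑-single enumeration t (λ t′ t′≢t → δ-≢ points
        (λ y≡′ → t′≢t (proj₂ (plane-injective (d≢0 , e∉⟨d⟩) p (trans (sym y≡′) y≡))))))
      (δ-≡ points y≡))

    multiplicity-out : ∀ {y} → ¬ InPlane y → multiplicity y ≡ 0ℤ
    multiplicity-out y∉ = ∑-zero enumeration (λ s → ∑-zero enumeration (λ t → δ-≢ points (λ y≡ → y∉ (s , t , y≡))))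

    balance : ∀ y → χ y (select (inPlane? y)) + multiplicity y * χ y d ≡ χ y d + multiplicity y * χ y e
    balance y = go (inPlane? y)
      where
      go : (y? : Dec (InPlane y)) → χ y (select y?) + multiplicity y * χ y d ≡ χ y d + multiplicity y * χ y e
      go (yes y∈) rewrite multiplicity-in y∈ = swap (χ y e) (χ y d)
        where
        swap : ∀ a b → a + 1ℤ * b ≡ b + 1ℤ * a
        swap = solve-∀
      go (no y∉) rewrite multiplicity-out y∉ = refl

    -- The switched spread and the parallel class of `d` have the same total q x. They differ only
    -- inside the plane, so their contributions there agree; `balance` states this pointwise without
    -- subtraction.
    plane-sums : ∑ᴷ (λ s → ∑ᴷ (λ t → χ (pt s t) d)) ≡ ∑ᴷ (λ s → ∑ᴷ (λ t → χ (pt s t) e))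
    plane-sums = +-cancelˡ (+ q * + x) _ _ (begin
      + q * + x + ∑ᴷ (λ s → ∑ᴷ (λ t → χ (pt s t) d))
        ≡⟨ cong₂ _+_ (sym (∑-directionField switched)) (sym (∑-image₂ points enumeration enumeration pt (λ y → χ y d))) ⟩
      ∑ᴾ (λ y → χ y (select (inPlane? y))) + ∑ᴾ (λ y → multiplicity y * χ y d)
        ≡⟨ ∑-+ points _ _ ⟨
      ∑ᴾ (λ y → χ y (select (inPlane? y)) + multiplicity y * χ y d)
        ≡⟨ ∑-cong points balance ⟩
      ∑ᴾ (λ y → χ y d + multiplicity y * χ y e)
        ≡⟨ ∑-+ points _ _ ⟩
      ∑ᴾ (λ y → χ y d) + ∑ᴾ (λ y → multiplicity y * χ y e)
        ≡⟨ cong₂ _+_ (∑ᴾ-χ d≢0) (∑-image₂ points enumeration enumeration pt (λ y → χ y e)) ⟩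
      + q * + x + ∑ᴷ (λ s → ∑ᴷ (λ t → χ (pt s t) e)) ∎)

  -- The plane degenerates to the line p + ⟨d⟩, and every summand on either side is χ(p, d).
  parallel-collinear : ∀ p d c → ¬ c ≡ 0# → parallel p d (c · d) ≡ parallel p (c · d) d
  parallel-collinear p d c c≢0 = ∑-cong enumeration (λ s → begin
    χ (p ⊕ (s · d)) (c · d)       ≡⟨ χ-scale _ d c≢0 ⟩
    χ (p ⊕ (s · d)) d             ≡⟨ χ-shift p s d ⟩
    χ p d                         ≡⟨ χ-shift p (s *ᴷ c) d ⟨
    χ (p ⊕ ((s *ᴷ c) · d)) d      ≡⟨ cong (λ v → χ (p ⊕ v) d) (·-assoc s c d) ⟩
    χ (p ⊕ (s · (c · d))) d       ∎)

  instance
    q-nonZero : ℕ.NonZero q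
    q-nonZero = nonZeroIndex (from enumeration 0#)

  -- For independent directions `plane-sums` counts each line of the plane once per point, so
  -- dividing by q compares the numbers of lines.
  parallel-sym : ∀ p {d e} → ¬ d ≡ zeroVec → ¬ e ≡ zeroVec → parallel p d e ≡ parallel p e d
  parallel-sym p {d} {e} d≢0 e≢0 with any-finite? enumeration (λ c → e ≟ᵛ (c · d))
  ... | yes (c , refl) = parallel-collinear p d c λ { refl → e≢0 (·-zeroˡ d) }
  ... | no e∉⟨d⟩ = *-cancelˡ-≡ (+ q) _ _ (begin
    + q * parallel p d e                                       ≡⟨ ∑-parallel p d e ⟨
    ∑ᴷ (λ s → ∑ᴷ (λ t → χ ((p ⊕ (s · d)) ⊕ (t · e)) e))        ≡⟨ PlaneSwitch.plane-sums p d e d≢0 e≢0 (λ c eq → e∉⟨d⟩ (c , eq)) ⟨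
    ∑ᴷ (λ s → ∑ᴷ (λ t → χ ((p ⊕ (s · d)) ⊕ (t · e)) d))        ≡⟨ ∑-swap enumeration enumeration _ ⟩
    ∑ᴷ (λ t → ∑ᴷ (λ s → χ ((p ⊕ (s · d)) ⊕ (t · e)) d))
      ≡⟨ ∑-cong enumeration (λ t → ∑-cong enumeration (λ s → cong (λ y → χ y d) (⊕-exchange p _ _))) ⟩
    ∑ᴷ (λ t → ∑ᴷ (λ s → χ ((p ⊕ (t · e)) ⊕ (s · d)) d))        ≡⟨ ∑-parallel p e d ⟩
    + q * parallel p e d                                       ∎)

  -- Stars and their sums along a line.

  -- Each line of 𝓛 through p is counted q − 1 times.
  star : Point → ℤ
  star p = ∑ᴾ (χ p)

  parallel-zeroˡ : ∀ p d → parallel p zeroVec d ≡ + q * χ p d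
  parallel-zeroˡ p d = trans (∑-cong enumeration
    (λ s → cong (λ y → χ y d) (trans (cong (p ⊕_) (·-zeroʳ s)) (⊕-identityʳ p)))) (∑-const enumeration _)

  parallel-zeroʳ : ∀ p d → parallel p d zeroVec ≡ 0ℤ
  parallel-zeroʳ p d = ∑-zero enumeration (λ s → χ-zero _ refl)

  scaling : ∀ s → ¬ s ≡ 0# → K ↔ K
  scaling s s≢0 with b , sb≡1 ← inverse s s≢0 = mk↔ₛ′ (s *ᴷ_) (b *ᴷ_)
    (λ a → cancel s b a sb≡1) (λ a → cancel b s a (trans (R.*-comm b s) sb≡1))
    where
    cancel : ∀ s b a → s *ᴷ b ≡ 1# → s *ᴷ (b *ᴷ a) ≡ a
    cancel s b a sb≡1 = trans (sym (R.*-assoc s b a)) (trans (cong (_*ᴷ a) sb≡1) (R.*-identityˡ a))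

  homothety : Point → ∀ s → ¬ s ≡ 0# → Point ↔ Point
  homothety p s s≢0 with b , sb≡1 ← inverse s s≢0 = mk↔ₛ′ (λ e → p ⊕ (s · e)) (λ y → b · (y ⊕ ((-ᴷ 1#) · p)))
    (λ y → begin
      p ⊕ (s · (b · (y ⊕ ((-ᴷ 1#) · p))))   ≡⟨ cong (p ⊕_) (cancel s b _ sb≡1) ⟩
      p ⊕ (y ⊕ ((-ᴷ 1#) · p))               ≡⟨ ⊕-comm p _ ⟩
      (y ⊕ ((-ᴷ 1#) · p)) ⊕ p               ≡⟨ cong ((y ⊕ ((-ᴷ 1#) · p)) ⊕_) (·-identity p) ⟨
      (y ⊕ ((-ᴷ 1#) · p)) ⊕ (1# · p)        ≡⟨ ⊕-·-inverseˡ y 1# p ⟩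
      y                                     ∎)
    (λ e → begin
      b · ((p ⊕ (s · e)) ⊕ ((-ᴷ 1#) · p))   ≡⟨ cong (λ w → b · (w ⊕ ((-ᴷ 1#) · p))) (trans (⊕-comm p _) (cong ((s · e) ⊕_) (sym (·-identity p)))) ⟩
      b · (((s · e) ⊕ (1# · p)) ⊕ ((-ᴷ 1#) · p))   ≡⟨ cong (b ·_) (⊕-·-inverseʳ (s · e) 1# p) ⟩
      b · (s · e)                           ≡⟨ cancel b s e (trans (R.*-comm b s) sb≡1) ⟩
      e                                     ∎)
    where
    cancel : ∀ s b u → s *ᴷ b ≡ 1# → s · (b · u) ≡ u
    cancel s b u sb≡1 = trans (sym (·-assoc s b u)) (trans (cong (_· u) sb≡1) (·-identity u))

  -- Summing `star` along p + ⟨d⟩ gives the sum of `parallel p d e` over all e, where `parallel-sym`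
  -- exchanges d and e. Then χ(p + s e, d) is summed over e: for s ≠ 0 the point p + s e runs
  -- through the whole space and gives q x, for s = 0 it stays at p and gives v χ(p, d). The extra q
  -- χ(p, d) on the left corrects e = 0, and the extra q x corrects s = 0.
  ∑-star : ∀ p {d} → ¬ d ≡ zeroVec →
           ∑ᴷ (λ s → star (p ⊕ (s · d))) + + q * χ p d + + q * + x ≡ + q * (+ q * + x) + v * χ p d
  ∑-star p {d} d≢0 = begin
    ∑ᴷ (λ s → star (p ⊕ (s · d))) + + q * χ p d + + q * + x
      ≡⟨ cong (λ c → c + + q * χ p d + + q * + x) (∑-swap enumeration points _) ⟩
    ∑ᴾ (λ e → parallel p d e) + + q * χ p d + + q * + x
      ≡⟨ cong (λ c → ∑ᴾ (λ e → parallel p d e) + c + + q * + x) (parallel-zeroˡ p d) ⟨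
    ∑ᴾ (λ e → parallel p d e) + parallel p zeroVec d + + q * + x
      ≡⟨ cong (_+ + q * + x) (∑-except points zeroVec (λ e e≢0 → parallel-sym p d≢0 e≢0)) ⟩
    ∑ᴾ (λ e → parallel p e d) + parallel p d zeroVec + + q * + x
      ≡⟨ cong (_+ + q * + x) (trans (cong (λ c → ∑ᴾ (λ e → parallel p e d) + c) (parallel-zeroʳ p d)) (+-identityʳ (∑ᴾ (λ e → parallel p e d)))) ⟩
    ∑ᴾ (λ e → parallel p e d) + + q * + x
      ≡⟨ cong (_+ + q * + x) (∑-swap points enumeration _) ⟩
    ∑ᴷ (λ s → ∑ᴾ (λ e → χ (p ⊕ (s · e)) d)) + + q * + x
      ≡⟨ ∑-except enumeration 0# (λ s s≢0 → trans (∑-reindex points (homothety p s s≢0) (λ y → χ y d)) (∑ᴾ-χ d≢0)) ⟩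
    ∑ᴷ (λ _ → + q * + x) + ∑ᴾ (λ e → χ (p ⊕ (0# · e)) d)
      ≡⟨ cong₂ _+_ (∑-const enumeration _) (trans (∑-cong points (λ e → cong (λ y → χ y d) (⊕-0· p e))) (∑-const points _)) ⟩
    + q * (+ q * + x) + v * χ p d ∎

  -- This is q - 1 times the difference between the number of lines of `𝓛` through p and x. The
  -- shift absorbs the constants of `∑-star`, so that sums along lines become multiples of χ.
  excess : Point → ℤ
  excess p = star p + (1ℤ - + q) * + x

  ∑-excess : ∀ p {d} → ¬ d ≡ zeroVec → ∑ᴷ (λ s → excess (p ⊕ (s · d))) ≡ (v - + q) * χ p d
  ∑-excess p {d} d≢0 = begin
    ∑ᴷ (λ s → excess (p ⊕ (s · d)))
      ≡⟨ trans (∑-+ enumeration _ _) (cong (λ c → ∑* + c) (∑-const enumeration _)) ⟩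
    ∑* + + q * ((1ℤ - + q) * + x)
      ≡⟨ rearrange ∑* (+ q) (χ p d) (+ x) ⟩
    (∑* + + q * χ p d + + q * + x) - + q * (+ q * + x) - + q * χ p d
      ≡⟨ cong (λ c → c - + q * (+ q * + x) - + q * χ p d) (∑-star p d≢0) ⟩
    (+ q * (+ q * + x) + v * χ p d) - + q * (+ q * + x) - + q * χ p d
      ≡⟨ collect (+ q * (+ q * + x)) v (+ q) (χ p d) ⟩
    (v - + q) * χ p d ∎
    where
    ∑* = ∑ᴷ (λ s → star (p ⊕ (s · d)))
    rearrange : ∀ t q c x → t + q * ((1ℤ - q) * x) ≡ (t + q * c + q * x) - q * (q * x) - q * c
    rearrange = solve-∀
    collect : ∀ a v q c → (a + v * c) - a - q * c ≡ (v - q) * c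
    collect = solve-∀

  -- The point weight and its quadratic relation.

  module Pencil (d e : Point) (e≢0 : ¬ e ≡ zeroVec) (d+be≢0 : ∀ b → ¬ d ⊕ (b · e) ≡ zeroVec) where

    -- The directions d + b e and e represent all lines through p in the plane p + ⟨d, e⟩.
    pencil : Point → ℤ
    pencil p = χ p e + ∑ᴷ (λ b → χ p (d ⊕ (b · e)))

    -- The number k(p) of the overview, taken at every point in the plane with the same two
    -- directions.
    weight : Point → ℤ
    weight p = pencil p - parallel p d e

    -- The sum of `excess` over the plane p + ⟨d, e⟩ is taken along the q + 1 lines through p and
    -- along the q lines parallel to e. The first way counts p itself q times too often, and
    -- `∑-excess` evaluates both.
    q*excess : ∀ p → + q * excess p ≡ (v - + q) * weight p
    q*excess p = begin
      + q * excess p                          ≡⟨ at-0 ⟨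
      A 0#                                    ≡⟨ isolate (∑ᴷ A) (B 0#) (∑ᴷ B) (A 0#) (∑-except enumeration 0# A≡B) ⟩
      B 0# + ∑ᴷ A - ∑ᴷ B                      ≡⟨ cong₂ _-_ (cong₂ _+_ B0 ∑A) ∑B ⟩
      (v - + q) * χ p e + (v - + q) * ∑ᴷ (λ b → χ p (d ⊕ (b · e))) - (v - + q) * parallel p d e
        ≡⟨ collect (v - + q) _ _ _ ⟩
      (v - + q) * weight p                    ∎
      where
      A B : K → ℤ
      A s = ∑ᴷ (λ b → excess (p ⊕ (s · (d ⊕ (b · e)))))
      B s = ∑ᴷ (λ b → excess ((p ⊕ (s · d)) ⊕ (b · e)))
      at-0 : A 0# ≡ + q * excess p
      at-0 = trans (∑-cong enumeration (λ b → cong excess (⊕-0· p _))) (∑-const enumeration _)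
      -- For s ≠ 0 the points p + s (d + b e) run over the line p + s d + ⟨e⟩ as b varies, with s b
      -- as the new parameter.
      A≡B : ∀ s → s ≢ 0# → A s ≡ B s
      A≡B s s≢0 = begin
        A s
          ≡⟨ ∑-cong enumeration (λ b → cong excess (begin
               p ⊕ (s · (d ⊕ (b · e)))             ≡⟨ cong (p ⊕_) (·-distribˡ s d _) ⟩
               p ⊕ ((s · d) ⊕ (s · (b · e)))       ≡⟨ ⊕-assoc p _ _ ⟨
               (p ⊕ (s · d)) ⊕ (s · (b · e))       ≡⟨ cong ((p ⊕ (s · d)) ⊕_) (·-assoc s b e) ⟨
               (p ⊕ (s · d)) ⊕ ((s *ᴷ b) · e)      ∎)) ⟩
        ∑ᴷ (λ b → excess ((p ⊕ (s · d)) ⊕ ((s *ᴷ b) · e)))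
          ≡⟨ ∑-reindex enumeration (scaling s s≢0) (λ b → excess ((p ⊕ (s · d)) ⊕ (b · e))) ⟩
        B s ∎
      B0 : B 0# ≡ (v - + q) * χ p e
      B0 = trans (∑-cong enumeration (λ b → cong (λ y → excess (y ⊕ (b · e))) (⊕-0· p d))) (∑-excess p e≢0)
      ∑A : ∑ᴷ A ≡ (v - + q) * ∑ᴷ (λ b → χ p (d ⊕ (b · e)))
      ∑A = trans (∑-swap enumeration enumeration _)
        (trans (∑-cong enumeration (λ b → ∑-excess p (d+be≢0 b))) (∑-*ˡ enumeration (v - + q) _))
      ∑B : ∑ᴷ B ≡ (v - + q) * parallel p d e
      ∑B = trans (∑-cong enumeration (λ s → ∑-excess (p ⊕ (s · d)) e≢0)) (∑-*ˡ enumeration (v - + q) _)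
      isolate : ∀ a b c d → a + b ≡ c + d → d ≡ b + a - c
      isolate a b c d eq = trans (move c d) (trans (cong (_- c) (sym eq)) (cong (_- c) (+-comm a b)))
        where
        move : ∀ c d → d ≡ c + d - c
        move = solve-∀
      collect : ∀ w a b c → w * a + w * b - w * c ≡ w * ((a + b) - c)
      collect = solve-∀

    module _ (g : ℤ) {{g≢0 : NonZero g}} {{q-1≢0 : NonZero (+ q - 1ℤ)}}
             (qⁿ≡ : v ≡ + q + + q * ((+ q - 1ℤ) * g)) where

      private
        r : ℤ
        r = + q - 1ℤ

        instance
          rg≢0 : NonZero (r * g)
          rg≢0 = i*j≢0 r g

        v-q : v - + q ≡ + q * (r * g)
        v-q = trans (cong (_- + q) qⁿ≡) (drop (+ q) (+ q * (r * g)))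
          where
          drop : ∀ a b → a + b - a ≡ b
          drop = solve-∀

      -- With `g` in the role of [n-1], v - q equals q (q - 1) g, and q cancels. Hence p lies on g
      -- k(p) + x lines of `𝓛`.
      excess≡weight : ∀ p → excess p ≡ r * g * weight p
      excess≡weight p = *-cancelˡ-≡ (+ q) _ _ (begin
        + q * excess p               ≡⟨ q*excess p ⟩
        (v - + q) * weight p         ≡⟨ cong (_* weight p) v-q ⟩
        + q * (r * g) * weight p     ≡⟨ *-assoc (+ q) (r * g) (weight p) ⟩
        + q * (r * g * weight p)     ∎)

      -- Cancelling (q - 1) g in `∑-excess` shows that the weights determine `𝓛`: along a line they
      -- sum to q or to 0.
      ∑-weight-line : ∀ p {d} → ¬ d ≡ zeroVec → ∑ᴷ (λ s → weight (p ⊕ (s · d))) ≡ + q * χ p d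
      ∑-weight-line p {d} d≢0 = *-cancelˡ-≡ (r * g) _ _ (begin
        r * g * ∑ᴷ (λ s → weight (p ⊕ (s · d)))      ≡⟨ ∑-*ˡ enumeration (r * g) _ ⟨
        ∑ᴷ (λ s → r * g * weight (p ⊕ (s · d)))      ≡⟨ ∑-cong enumeration (λ s → excess≡weight (p ⊕ (s · d))) ⟨
        ∑ᴷ (λ s → excess (p ⊕ (s · d)))              ≡⟨ ∑-excess p d≢0 ⟩
        (v - + q) * χ p d                            ≡⟨ cong (_* χ p d) v-q ⟩
        + q * (r * g) * χ p d                        ≡⟨ cong (_* χ p d) (*-comm (+ q) (r * g)) ⟩
        r * g * + q * χ p d                          ≡⟨ *-assoc (r * g) (+ q) (χ p d) ⟩
        r * g * (+ q * χ p d)                        ∎)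

      -- Each of the q translations along `d` preserves the sum over points; adding them up allows
      -- evaluation line by line.
      ∑ᴾ-lines : ∀ f d → + q * ∑ᴾ f ≡ ∑ᴾ (λ p → ∑ᴷ (λ s → f (p ⊕ (s · d))))
      ∑ᴾ-lines f d = begin
        + q * ∑ᴾ f                                   ≡⟨ ∑-const enumeration _ ⟨
        ∑ᴷ (λ _ → ∑ᴾ f)                              ≡⟨ ∑-cong enumeration (λ s → ∑ᴾ-shift f s d) ⟨
        ∑ᴷ (λ s → ∑ᴾ (λ p → f (p ⊕ (s · d))))        ≡⟨ ∑-swap enumeration points _ ⟩
        ∑ᴾ (λ p → ∑ᴷ (λ s → f (p ⊕ (s · d))))        ∎

      ∑-weight : ∑ᴾ weight ≡ + q * + x
      ∑-weight = *-cancelˡ-≡ (+ q) _ _ (begin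
        + q * ∑ᴾ weight                              ≡⟨ ∑ᴾ-lines weight e ⟩
        ∑ᴾ (λ p → ∑ᴷ (λ s → weight (p ⊕ (s · e))))   ≡⟨ ∑-cong points (λ p → ∑-weight-line p e≢0) ⟩
        ∑ᴾ (λ p → + q * χ p e)                       ≡⟨ ∑-*ˡ points (+ q) _ ⟩
        + q * ∑ᴾ (λ p → χ p e)                       ≡⟨ cong (λ c → + q * c) (∑ᴾ-χ e≢0) ⟩
        + q * (+ q * + x)                            ∎)

      -- Lines outside `𝓛` have total weight 0, so restricting to the lines of `𝓛` in direction `d`
      -- does not change the sum of all weights.
      ∑-weight-χ : ∀ {d} → ¬ d ≡ zeroVec → ∑ᴾ (λ p → weight p * χ p d) ≡ + q * + x
      ∑-weight-χ {d} d≢0 = *-cancelˡ-≡ (+ q) _ _ (begin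
        + q * ∑ᴾ (λ p → weight p * χ p d)
          ≡⟨ ∑ᴾ-lines (λ p → weight p * χ p d) d ⟩
        ∑ᴾ (λ p → ∑ᴷ (λ s → weight (p ⊕ (s · d)) * χ (p ⊕ (s · d)) d))
          ≡⟨ ∑-cong points on-line ⟩
        ∑ᴾ (λ p → + q * χ p d)
          ≡⟨ ∑-*ˡ points (+ q) _ ⟩
        + q * ∑ᴾ (λ p → χ p d)
          ≡⟨ cong (λ c → + q * c) (∑ᴾ-χ d≢0) ⟩
        + q * (+ q * + x) ∎)
        where
        on-line : ∀ p → ∑ᴷ (λ s → weight (p ⊕ (s · d)) * χ (p ⊕ (s · d)) d) ≡ + q * χ p d
        on-line p = begin
          ∑ᴷ (λ s → weight (p ⊕ (s · d)) * χ (p ⊕ (s · d)) d)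
            ≡⟨ ∑-cong enumeration (λ s → cong (λ c → weight (p ⊕ (s · d)) * c) (χ-shift p s d)) ⟩
          ∑ᴷ (λ s → weight (p ⊕ (s · d)) * χ p d)    ≡⟨ ∑-*ʳ enumeration (χ p d) _ ⟩
          ∑ᴷ (λ s → weight (p ⊕ (s · d))) * χ p d    ≡⟨ cong (_* χ p d) (∑-weight-line p d≢0) ⟩
          + q * χ p d * χ p d                        ≡⟨ *-assoc (+ q) (χ p d) (χ p d) ⟩
          + q * (χ p d * χ p d)                      ≡⟨ cong (λ c → + q * c) (χ-idem p d) ⟩
          + q * χ p d                                ∎

      -- The count of incident pairs by direction: every nonzero vector contributes q x, and the
      -- added q x stands in for the zero vector. Each pair is counted q - 1 times, as in `star`.
      ∑-weight-star : ∑ᴾ (λ p → weight p * star p) + + q * + x ≡ v * (+ q * + x)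
      ∑-weight-star = begin
        ∑ᴾ (λ p → weight p * star p) + + q * + x
          ≡⟨ cong (_+ + q * + x) (trans (∑-cong points (λ p → sym (∑-*ˡ points (weight p) (χ p)))) (∑-swap points points _)) ⟩
        ∑ᴾ (λ d → ∑ᴾ (λ p → weight p * χ p d)) + + q * + x
          ≡⟨ ∑-except points zeroVec (λ d d≢0 → ∑-weight-χ d≢0) ⟩
        ∑ᴾ (λ _ → + q * + x) + ∑ᴾ (λ p → weight p * χ p zeroVec)
          ≡⟨ cong₂ _+_ (∑-const points _) (∑-zero points (λ p → trans (cong (λ c → weight p * c) (χ-zero p refl)) (*-zeroʳ (weight p)))) ⟩
        v * (+ q * + x) + 0ℤ
          ≡⟨ +-identityʳ _ ⟩
        v * (+ q * + x) ∎

      ∑weight² : ℤ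
      ∑weight² = ∑ᴾ (λ p → weight p * weight p)

      -- The count by points: inserting `star` p = (q - 1) (g k(p) + x) into `∑-weight-star` and
      -- cancelling q - 1. The right side is q x [n], because [n] = 1 + q [n-1].
      quadratic : g * ∑weight² + + q * + x * + x ≡ + q * + x + + q * + q * g * + x
      quadratic = *-cancelˡ-≡ r _ _ (+-cancelʳ (+ q * + x) _ _ (begin
        r * (g * ∑weight² + + q * + x * + x) + + q * + x
          ≡⟨ cong (_+ + q * + x) (expand r g ∑weight² (+ q) (+ x)) ⟩
        r * g * ∑weight² + r * + x * (+ q * + x) + + q * + x
          ≡⟨ cong (λ c → c + + q * + x) (cong₂ _+_ (∑-*ˡ points (r * g) _) (trans (∑-*ˡ points (r * + x) weight) (cong (λ c → r * + x * c) ∑-weight))) ⟨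
        ∑ᴾ (λ p → r * g * (weight p * weight p)) + ∑ᴾ (λ p → r * + x * weight p) + + q * + x
          ≡⟨ cong (_+ + q * + x) (∑-+ points _ _) ⟨
        ∑ᴾ (λ p → r * g * (weight p * weight p) + r * + x * weight p) + + q * + x
          ≡⟨ cong (_+ + q * + x) (∑-cong points pointwise) ⟨
        ∑ᴾ (λ p → weight p * star p) + + q * + x
          ≡⟨ ∑-weight-star ⟩
        v * (+ q * + x)
          ≡⟨ cong (_* (+ q * + x)) qⁿ≡ ⟩
        (+ q + + q * (r * g)) * (+ q * + x)
          ≡⟨ collect (+ q) g (+ x) ⟩
        r * (+ q * + x + + q * + q * g * + x) + + q * + x ∎))
        where
        expand : ∀ r g s q x → r * (g * s + q * x * x) ≡ r * g * s + r * x * (q * x)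
        expand = solve-∀
        collect : ∀ q g x → (q + q * ((q - 1ℤ) * g)) * (q * x) ≡ (q - 1ℤ) * (q * x + q * q * g * x) + q * x
        collect = solve-∀
        factor : ∀ w s q x → w * s ≡ w * (s + (1ℤ - q) * x) + (q - 1ℤ) * x * w
        factor = solve-∀
        pointwise : ∀ p → weight p * star p ≡ r * g * (weight p * weight p) + r * + x * weight p
        pointwise p = begin
          weight p * star p                                         ≡⟨ factor (weight p) (star p) (+ q) (+ x) ⟩
          weight p * excess p + r * + x * weight p                  ≡⟨ cong (λ c → weight p * c + r * + x * weight p) (excess≡weight p) ⟩
          weight p * (r * g * weight p) + r * + x * weight p        ≡⟨ cong (_+ r * + x * weight p) (swap (weight p) (r * g)) ⟩
          r * g * (weight p * weight p) + r * + x * weight p        ∎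
          where
          swap : ∀ w c → w * (c * w) ≡ c * (w * w)
          swap = solve-∀

      -- In `quadratic`, Σ k² becomes q x + 2 z and q² becomes q + 2 w. The terms q g x cancel, and
      -- 2 g (w x - z) remains.
      ∃q*x[x-1] : ∃[ y ] (+ q * (+ x * + x - + x) ≡ + 2 * (g * y))
      ∃q*x[x-1] with w , q²≡ ← square-parity (+ q) = w * + x - z , (begin
        + q * (+ x * + x - + x)
          ≡⟨ isolate (+ q) (+ x) (g * ∑weight²) ⟩
        g * ∑weight² + + q * + x * + x - + q * + x - g * ∑weight²
          ≡⟨ cong₂ (λ a b → a - + q * + x - g * b) quadratic ∑weight²≡ ⟩
        + q * + x + + q * + q * g * + x - + q * + x - g * (+ q * + x + + 2 * z)
          ≡⟨ cong (λ a → + q * + x + a * g * + x - + q * + x - g * (+ q * + x + + 2 * z)) q²≡ ⟩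
        + q * + x + (+ q + + 2 * w) * g * + x - + q * + x - g * (+ q * + x + + 2 * z)
          ≡⟨ collect (+ q) (+ x) w g z ⟩
        + 2 * (g * (w * + x - z)) ∎)
        where
        z : ℤ
        z = ∑ᴾ (λ p → proj₁ (square-parity (weight p)))
        ∑weight²≡ : ∑weight² ≡ + q * + x + + 2 * z
        ∑weight²≡ = trans (∑-cong points (λ p → proj₂ (square-parity (weight p))))
          (trans (∑-+ points _ _) (cong₂ _+_ ∑-weight (∑-*ˡ points (+ 2) _)))
        isolate : ∀ q x a → q * (x * x - x) ≡ a + q * x * x - q * x - a
        isolate = solve-∀
        collect : ∀ q x w g z → q * x + (q + + 2 * w) * g * x - q * x - g * (q * x + + 2 * z) ≡ + 2 * (g * (w * x - z))
        collect = solve-∀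

-- Passage to natural numbers and the final divisibility.

module _ where
  open IntegerSums

  gaussNum∣q*x*[x∸1] : ∀ {q} → 2 ℕ.≤ q → (m : ℕ) (F : FiniteField q)
    (𝓛 : AffineSpace.LineSet F (suc (suc (suc m)))) (x : ℕ) →
    AffineSpace.IsCameronLieblerLineClass F (suc (suc (suc m))) 𝓛 x →
    ∃[ y ] (q ℕ.* (x ℕ.* (x ℕ.∸ 1)) ≡ 2 ℕ.* (gaussNum q (suc (suc m)) ℕ.* y))
  -- Matching on `2 ≤ q` makes `+ q - 1ℤ` compute to a positive integer, so both q - 1 and g can be
  -- cancelled. The quotient `y` may be negative, hence the absolute values.
  gaussNum∣q*x*[x∸1] {q} (ℕ.s≤s (ℕ.s≤s ℕ.z≤n)) m F 𝓛 x cameronLiebler = ∣ y ∣ , (begin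
    q ℕ.* c                        ≡⟨ abs-* (+ q) (+ c) ⟨
    ∣ + q * + c ∣                  ≡⟨ cong (λ a → ∣ + q * a ∣) (pos-x*[x∸1] x) ⟩
    ∣ + q * (+ x * + x - + x) ∣    ≡⟨ cong ∣_∣ q*x[x-1] ⟩
    ∣ + 2 * (+ g * y) ∣            ≡⟨ abs-* (+ 2) (+ g * y) ⟩
    2 ℕ.* ∣ + g * y ∣              ≡⟨ cong (2 ℕ.*_) (abs-* (+ g) y) ⟩
    2 ℕ.* (g ℕ.* ∣ y ∣)            ∎)
    where
    open ≡-Reasoning
    open FiniteField F using (0#; 1#; 0≢1; isCommutativeRing)
    open AffineSpace F (suc (suc (suc m))) using (Point; _⊕_; _·_; zeroVec)
    module R = IsCommutativeRing isCommutativeRing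

    c g : ℕ
    c = x ℕ.* (x ℕ.∸ 1)
    g = gaussNum q (suc (suc m))

    -- The first two unit vectors: the first coordinate of every d + b e is 1.
    d e : Point
    d = 1# ∷ replicate _ 0#
    e = 0# ∷ 1# ∷ replicate _ 0#

    e≢0 : ¬ e ≡ zeroVec
    e≢0 eq = 0≢1 (sym (∷-injectiveˡ (∷-injectiveʳ eq)))

    d+be≢0 : ∀ b → ¬ d ⊕ (b · e) ≡ zeroVec
    d+be≢0 b eq = 0≢1 (sym (trans
      (sym (trans (R.+-congˡ (R.zeroʳ b)) (R.+-identityʳ 1#))) (∷-injectiveˡ eq)))

    solution = CameronLiebler.Pencil.∃q*x[x-1] F _ 𝓛 x cameronLiebler d e e≢0 d+be≢0
      (+ g) (^-gaussNum q (suc (suc m)))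
    y = proj₁ solution
    q*x[x-1] = proj₂ solution

open import Data.Nat using (_≤_; _*_; _+_; _∸_)
open import Data.Nat.Properties using (+-comm; *-comm; *-assoc)
open import Data.Nat.Tactic.RingSolver using (solve-∀)

2∣n*[n∸1] : ∀ n → 2 ∣ n * (n ∸ 1)
2∣n*[n∸1] zero          = 2 ∣0
2∣n*[n∸1] (suc zero)    = 2 ∣0
2∣n*[n∸1] (suc (suc n)) = subst (2 ∣_) (expand n) (∣m∣n⇒∣m+n (2∣n*[n∸1] (suc n)) (m∣m*n (suc n)))
  where
  expand : ∀ n → suc n * n + 2 * suc n ≡ suc (suc n) * suc n
  expand = solve-∀

theorem3p1 : (n : ℕ) → 3 ≤ n → (q : ℕ) (F : FiniteField q)
    (𝓛 : AffineSpace.LineSet F n) (x : ℕ)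
    → AffineSpace.IsCameronLieblerLineClass F n 𝓛 x
    → (2 * (q + 1)) ∣ (x * (x ∸ 1) * gaussNum q (n ∸ 2))
theorem3p1 (suc (suc (suc m))) (ℕ.s≤s (ℕ.s≤s (ℕ.s≤s ℕ.z≤n))) q F 𝓛 x cameronLiebler
  with y , q*c≡2gy ← gaussNum∣q*x*[x∸1] (field-size F) m F 𝓛 x cameronLiebler =
  -- Writing z as (q + 1) z − q z avoids distinguishing the parity of q.
  ∣m+n∣m⇒∣n (subst (2 * (q + 1) ∣_) (+-comm z (q * z)) 2[q+1]∣z+qz) 2[q+1]∣qz
  where
  open ≡-Reasoning
  c g g′ z : ℕ
  c  = x * (x ∸ 1)
  g  = gaussNum q (suc (suc m))
  g′ = gaussNum q (suc m)
  z  = c * g′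

  -- Multiplication by [n-2] completes the factor [n-1] of q x (x - 1) to [n-1] [n-2], which
  -- supplies q + 1.
  2[q+1]∣qz : 2 * (q + 1) ∣ q * z
  2[q+1]∣qz = subst (2 * (q + 1) ∣_) (sym (begin
    q * (c * g′)         ≡⟨ *-assoc q c g′ ⟨
    q * c * g′           ≡⟨ cong (_* g′) q*c≡2gy ⟩
    2 * (g * y) * g′     ≡⟨ rearrange g y g′ ⟩
    2 * (g * g′ * y)     ∎))
    (*-monoʳ-∣ 2 (∣m⇒∣m*n y (q+1∣gaussNum*gaussNum q (suc m))))
    where
    rearrange : ∀ g y g′ → 2 * (g * y) * g′ ≡ 2 * (g * g′ * y)
    rearrange = solve-∀

  -- Here the 2 comes from the consecutive numbers x - 1 and x, and q + 1 is an explicit factor.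
  2[q+1]∣z+qz : 2 * (q + 1) ∣ z + q * z
  2[q+1]∣z+qz = subst (2 * (q + 1) ∣_) (begin
    z * (q + 1)      ≡⟨ *-comm z (q + 1) ⟩
    (q + 1) * z      ≡⟨ cong (_* z) (+-comm q 1) ⟩
    z + q * z        ∎)
    (*-monoˡ-∣ (q + 1) (∣m⇒∣m*n g′ (2∣n*[n∸1] x)))
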